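{- There exists an abelian $9$-power free morphism $h:\Sigma^*\to\Sigma^*$ over the binary alphabet $\Sigma=\{a,b\}$ with an infinite fixed point $\Omega_2\in\Sigma^{\mathbb{N}}$ such that: (i) $aaaa$ is not a factor of $\Omega_2$; (ii) $bb$ is not a factor of $\Omega_2$; (iii) $\Omega_2$ is abelian $9$-power free.
   Context: $\Sigma^*$ is the free monoid of finite words over $\Sigma$, with empty word $\epsilon$. A morphism is a monoid homomorphism $h:\Sigma^*\to\Sigma^*$; it extends to infinite words letter by letter, and an infinite word $\Omega$ is a fixed point of $h$ if $h(\Omega)=\Omega$. A factor of a word is a contiguous finite subword. The Parikh vector $\psi(u)$ of a finite word $u$ records the number of occurrences of each letter in $u$. A word $u$ (finite or infinite) is abelian $k$-power free if whenever $u=xv_1\cdots v_ky$ with $\psi(v_1)=\cdots=\psi(v_k)$, one has $v_1=\cdots=v_k=\epsilon$. A morphism $h$ is abelian $n$-power free if $h(u)$ is abelian $n$-power free for every abelian $n$-power free word $u$. -}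

module Defs where

open import Data.Fin using (Fin)
open import Data.List using (List; []; _∷_; _++_; length; filter; concat; applyUpTo; ++-[]-rawMonoid)
open import Data.Nat using (ℕ; zero; suc)
open import Data.Product using (∃-syntax)
open import Data.Vec using (Vec; []; _∷_; lookup; toList)
open import Relation.Binary.Definitions using (DecidableEquality)
open import Relation.Binary.PropositionalEquality using (_≡_; _≗_; refl)
open import Relation.Nullary using (yes; no)
open import Algebra.Morphism.Structures using (module MonoidMorphisms)

data Letter : Set where
  a b : Letter

_≟_ : DecidableEquality Letter
a ≟ a = yes refl
a ≟ b = no λ ()
b ≟ a = no λ ()
b ≟ b = yes refl

Word : Set
Word = List Letter

InfWord : Set
InfWord = ℕ → Letter

open MonoidMorphisms (++-[]-rawMonoid Letter) (++-[]-rawMonoid Letter) public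
  using () renaming (IsMonoidHomomorphism to IsMorphism)

infixr 5 _++ω_

_++ω_ : Word → InfWord → InfWord
([]      ++ω w) n       = w n
((c ∷ u) ++ω w) zero    = c
((c ∷ u) ++ω w) (suc n) = (u ++ω w) n

prefix : InfWord → ℕ → Word
prefix = applyUpTo

-- h(w) = h(w₀)h(w₁)h(w₂)⋯ is the limit of the increasing words h(w₀⋯wₙ₋₁).
-- The relation says that this limit is the infinite word w′: every finite
-- prefix of w′ is a prefix of the image of some finite prefix of w.  In
-- particular it fails when h erases so much of w that h(w) is finite.
ImageIs : (Word → Word) → InfWord → InfWord → Set
ImageIs h w w′ = ∀ m → ∃[ n ] ∃[ y ] h (prefix w n) ≡ prefix w′ m ++ y

IsFixedPoint : (Word → Word) → InfWord → Set
IsFixedPoint h w = ImageIs h w w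

-- Infinite words are compared pointwise (_≗_), as there is no function
-- extensionality.
IsFactorω : Word → InfWord → Set
IsFactorω v w = ∃[ x ] ∃[ y ] w ≗ x ++ω v ++ω y

∣_∣⟨_⟩ : Word → Letter → ℕ
∣ u ∣⟨ c ⟩ = length (filter (c ≟_) u)

ψ : Word → Vec ℕ 2
ψ u = ∣ u ∣⟨ a ⟩ ∷ ∣ u ∣⟨ b ⟩ ∷ []

SameParikh : ∀ {k} → Vec Word k → Set
SameParikh {k} vs = (i j : Fin k) → ψ (lookup vs i) ≡ ψ (lookup vs j)

AllEmpty : ∀ {k} → Vec Word k → Set
AllEmpty {k} vs = (i : Fin k) → lookup vs i ≡ []

AbelianPowerFree : ℕ → Word → Set
AbelianPowerFree k u =
  (x : Word) (vs : Vec Word k) (y : Word) →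
  u ≡ x ++ concat (toList vs) ++ y → SameParikh vs → AllEmpty vs

AbelianPowerFreeω : ℕ → InfWord → Set
AbelianPowerFreeω k w =
  (x : Word) (vs : Vec Word k) (y : InfWord) →
  w ≗ x ++ω concat (toList vs) ++ω y → SameParikh vs → AllEmpty vs

AbelianPowerFreeMorphism : ℕ → (Word → Word) → Set
AbelianPowerFreeMorphism n h =
  (u : Word) → AbelianPowerFree n u → AbelianPowerFree n (h u)

{-# OPTIONS --safe #-}

-- Dekking's argument.  Give the letters the weights a ↦ 1 and b ↦ 3 in ℤ/11.
-- Both h(a) = abaaaba and h(b) = babab have weight 0, and the weights of their
-- prefixes avoid 2 and 9.  If v₁⋯v₉ is an abelian 9-power in h(u), the ten cuts
-- around its blocks have weights in arithmetic progression; as 11 is prime and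
-- two residues are avoided, the difference is 0.  So all ten cuts have the same
-- weight, and they can be moved to image boundaries by steps that depend, up to
-- abelian equivalence, on this weight only.  The moved cuts come from an abelian
-- 9-power in u, because the matrix of h has determinant 5·3 − 2·2 = 11 ≠ 0.
module Submission where

open import Defs
open import Data.Fin using (Fin; zero; suc; toℕ)
open import Data.Fin.Properties using (all?; any?; toℕ-fromℕ<; toℕ<n)
open import Data.List using (List; []; _∷_; _++_; length; concat; concatMap; filter)
open import Data.List.Properties using (++-assoc; ++-identityʳ; filter-++; length-++; concatMap-++; ∷-injectiveˡ; ∷-injectiveʳ)
open import Data.Nat using (ℕ; zero; suc; _+_; _*_; _∸_; _≤_; _<_; z≤n; s≤s; _%_; _/_)
import Data.Nat as ℕ
open import Data.Nat.Divisibility using (m%n≡0⇒n∣m)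
open import Data.Nat.DivMod using (m≡m%n+[m/n]*n; [m+kn]%n≡m%n; [m+n]%n≡m%n; %-remove-+ʳ; _mod_; m%n<n)
open import Data.Nat.Properties
  using (+-comm; +-assoc; +-identityʳ; +-cancelˡ-≡; +-cancelʳ-≡; *-cancelˡ-≡; *-monoʳ-≤;
    +-mono-≤; m+n≡0⇒m≡0; m+[n∸m]≡n; m≤m+n; m≤n+m; ≤-refl; ≤-reflexive; ≤-trans;
    <-≤-trans; <⇒≤; n<1+n; n≤1+n; n≮n;
    module ≤-Reasoning)
open import Data.Nat.Tactic.RingSolver using (solve-∀)
open import Data.Product using (_×_; _,_; ∃-syntax; proj₁; proj₂)
open import Data.Sum using (_⊎_; inj₁; inj₂)
open import Data.Vec using (Vec; []; _∷_; lookup; toList)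
import Data.Vec.Properties as Vec
open import Function.Base using (_∘_)
open import Relation.Binary.PropositionalEquality
  using (_≡_; _≗_; refl; sym; trans; cong; cong₂; subst; module ≡-Reasoning)
open import Relation.Nullary using (¬_; Dec; contradiction)
open import Relation.Nullary.Decidable using (_⊎-dec_; False; toWitness; toWitnessFalse)

-- Levi's lemma. It places a cut relative to an image boundary in `cut`, and orders successive moved
-- cuts in `desubstitute`.
levi : ∀ {A : Set} (s : List A) {t} z {z′} → s ++ t ≡ z ++ z′ →
       (∃[ w ] z ≡ s ++ w × t ≡ w ++ z′) ⊎ (∃[ w ] s ≡ z ++ w × z′ ≡ w ++ t)
levi []      z       eq = inj₁ (z , refl , eq)
levi (c ∷ s) []      eq = inj₂ (c ∷ s , refl , sym eq)
levi (c ∷ s) (d ∷ z) eq with ∷-injectiveˡ eq | levi s z (∷-injectiveʳ eq)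
... | refl | inj₁ (w , z≡ , t≡) = inj₁ (w , cong (c ∷_) z≡ , t≡)
... | refl | inj₂ (w , s≡ , z≡) = inj₂ (w , cong (c ∷_) s≡ , z≡)

-- The morphism

σ : Letter → Word
σ a = a ∷ b ∷ a ∷ a ∷ a ∷ b ∷ a ∷ []
σ b = b ∷ a ∷ b ∷ a ∷ b ∷ []

h : Word → Word
h = concatMap σ

h-++ : ∀ u v → h (u ++ v) ≡ h u ++ h v
h-++ = concatMap-++ σ

h-isMorphism : IsMorphism h
h-isMorphism = record
  { isMagmaHomomorphism = record
    { isRelHomomorphism = record { cong = cong h }
    ; homo = h-++
    }
  ; ε-homo = refl
  }

-- Parikh vectors

count-++ : ∀ u v c → ∣ u ++ v ∣⟨ c ⟩ ≡ ∣ u ∣⟨ c ⟩ + ∣ v ∣⟨ c ⟩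
count-++ u v c = trans (cong length (filter-++ (c ≟_) u v)) (length-++ (filter (c ≟_) u))

ψ-count : ∀ u v → ψ u ≡ ψ v → ∀ c → ∣ u ∣⟨ c ⟩ ≡ ∣ v ∣⟨ c ⟩
ψ-count u v eq a = Vec.∷-injectiveˡ eq
ψ-count u v eq b = Vec.∷-injectiveˡ (Vec.∷-injectiveʳ eq)

count-ψ : ∀ u v → (∀ c → ∣ u ∣⟨ c ⟩ ≡ ∣ v ∣⟨ c ⟩) → ψ u ≡ ψ v
count-ψ u v eq = cong₂ (λ m n → m ∷ n ∷ []) (eq a) (eq b)

count≡0⇒[] : ∀ u → (∀ c → ∣ u ∣⟨ c ⟩ ≡ 0) → u ≡ []
count≡0⇒[] []      _  = refl
count≡0⇒[] (a ∷ u) eq with () ← eq a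
count≡0⇒[] (b ∷ u) eq with () ← eq b

count-h≡0⇒[] : ∀ u → (∀ c → ∣ h u ∣⟨ c ⟩ ≡ 0) → u ≡ []
count-h≡0⇒[] []      _  = refl
count-h≡0⇒[] (a ∷ u) eq with () ← eq a
count-h≡0⇒[] (b ∷ u) eq with () ← eq b

count-h-a : ∀ u → ∣ h u ∣⟨ a ⟩ ≡ 5 * ∣ u ∣⟨ a ⟩ + 2 * ∣ u ∣⟨ b ⟩
count-h-a []      = refl
count-h-a (a ∷ u) = trans (cong (5 +_) (count-h-a u)) (step ∣ u ∣⟨ a ⟩ ∣ u ∣⟨ b ⟩)
  where
  step : ∀ m n → 5 + (5 * m + 2 * n) ≡ 5 * suc m + 2 * n
  step = solve-∀
count-h-a (b ∷ u) = trans (cong (2 +_) (count-h-a u)) (step ∣ u ∣⟨ a ⟩ ∣ u ∣⟨ b ⟩)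
  where
  step : ∀ m n → 2 + (5 * m + 2 * n) ≡ 5 * m + 2 * suc n
  step = solve-∀

count-h-b : ∀ u → ∣ h u ∣⟨ b ⟩ ≡ 2 * ∣ u ∣⟨ a ⟩ + 3 * ∣ u ∣⟨ b ⟩
count-h-b []      = refl
count-h-b (a ∷ u) = trans (cong (2 +_) (count-h-b u)) (step ∣ u ∣⟨ a ⟩ ∣ u ∣⟨ b ⟩)
  where
  step : ∀ m n → 2 + (2 * m + 3 * n) ≡ 2 * suc m + 3 * n
  step = solve-∀
count-h-b (b ∷ u) = trans (cong (3 +_) (count-h-b u)) (step ∣ u ∣⟨ a ⟩ ∣ u ∣⟨ b ⟩)
  where
  step : ∀ m n → 3 + (2 * m + 3 * n) ≡ 2 * m + 3 * suc n
  step = solve-∀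

-- Cramer's rule for the matrix of `h`. The terms with negative cofactors are moved to the other
-- side, so that all stays in ℕ.
count-h-injective : ∀ u v → (∀ c → ∣ h u ∣⟨ c ⟩ ≡ ∣ h v ∣⟨ c ⟩) →
                    ∀ c → ∣ u ∣⟨ c ⟩ ≡ ∣ v ∣⟨ c ⟩
count-h-injective u v eq = λ
  { a → *-cancelˡ-≡ _ _ 11 (+-cancelʳ-≡ (2 * ∣ h u ∣⟨ b ⟩) _ _ (begin
      11 * ∣ u ∣⟨ a ⟩ + 2 * ∣ h u ∣⟨ b ⟩  ≡⟨ cramer-a u ⟨
      3 * ∣ h u ∣⟨ a ⟩                    ≡⟨ cong (3 *_) (eq a) ⟩
      3 * ∣ h v ∣⟨ a ⟩                    ≡⟨ cramer-a v ⟩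
      11 * ∣ v ∣⟨ a ⟩ + 2 * ∣ h v ∣⟨ b ⟩  ≡⟨ cong (λ n → 11 * ∣ v ∣⟨ a ⟩ + 2 * n) (eq b) ⟨
      11 * ∣ v ∣⟨ a ⟩ + 2 * ∣ h u ∣⟨ b ⟩  ∎))
  ; b → *-cancelˡ-≡ _ _ 11 (+-cancelʳ-≡ (2 * ∣ h u ∣⟨ a ⟩) _ _ (begin
      11 * ∣ u ∣⟨ b ⟩ + 2 * ∣ h u ∣⟨ a ⟩  ≡⟨ cramer-b u ⟨
      5 * ∣ h u ∣⟨ b ⟩                    ≡⟨ cong (5 *_) (eq b) ⟩
      5 * ∣ h v ∣⟨ b ⟩                    ≡⟨ cramer-b v ⟩
      11 * ∣ v ∣⟨ b ⟩ + 2 * ∣ h v ∣⟨ a ⟩  ≡⟨ cong (λ n → 11 * ∣ v ∣⟨ b ⟩ + 2 * n) (eq a) ⟨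
      11 * ∣ v ∣⟨ b ⟩ + 2 * ∣ h u ∣⟨ a ⟩  ∎))
  }
  where
  open ≡-Reasoning
  cramer-a : ∀ w → 3 * ∣ h w ∣⟨ a ⟩ ≡ 11 * ∣ w ∣⟨ a ⟩ + 2 * ∣ h w ∣⟨ b ⟩
  cramer-a w rewrite count-h-a w | count-h-b w = ring ∣ w ∣⟨ a ⟩ ∣ w ∣⟨ b ⟩
    where
    ring : ∀ m n → 3 * (5 * m + 2 * n) ≡ 11 * m + 2 * (2 * m + 3 * n)
    ring = solve-∀
  cramer-b : ∀ w → 5 * ∣ h w ∣⟨ b ⟩ ≡ 11 * ∣ w ∣⟨ b ⟩ + 2 * ∣ h w ∣⟨ a ⟩
  cramer-b w rewrite count-h-a w | count-h-b w = ring ∣ w ∣⟨ a ⟩ ∣ w ∣⟨ b ⟩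
    where
    ring : ∀ m n → 5 * (2 * m + 3 * n) ≡ 11 * n + 2 * (5 * m + 2 * n)
    ring = solve-∀

-- The common vector is a parameter `π` and not read off the first block, so that the tail of `vs`
-- inherits the property in inductions.
HasParikh : ∀ {k} → (Letter → ℕ) → Vec Word k → Set
HasParikh {k} π vs = ∀ (i : Fin k) c → ∣ lookup vs i ∣⟨ c ⟩ ≡ π c

SameParikh⇒HasParikh : ∀ {k} (vs : Vec Word (suc k)) → SameParikh vs →
                       HasParikh (∣ lookup vs zero ∣⟨_⟩) vs
SameParikh⇒HasParikh vs same i = ψ-count (lookup vs i) (lookup vs zero) (same i zero)

HasParikh-0⇒AllEmpty : ∀ {k π} (vs : Vec Word k) → HasParikh π vs →
                       (∀ c → π c ≡ 0) → AllEmpty vs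
HasParikh-0⇒AllEmpty vs par π≡0 i = count≡0⇒[] (lookup vs i) λ c → trans (par i c) (π≡0 c)

++-regroup : ∀ (x v w y : Word) → x ++ (v ++ w) ++ y ≡ (x ++ v) ++ w ++ y
++-regroup x v w y = trans (cong (x ++_) (++-assoc v w y)) (sym (++-assoc x v (w ++ y)))

-- Induction on `i`, moving the first block into `x`. The cuts for `i = 0, …, k` have letter counts,
-- hence weights, in arithmetic progression.
cut-after : ∀ {k π i} (vs : Vec Word k) → HasParikh π vs → i ≤ k → ∀ x y →
            ∃[ z ] ∃[ z′ ] x ++ concat (toList vs) ++ y ≡ z ++ z′ ×
              (∀ c → ∣ z ∣⟨ c ⟩ ≡ ∣ x ∣⟨ c ⟩ + i * π c)
cut-after vs par z≤n x y = x , concat (toList vs) ++ y , refl , λ c → sym (+-identityʳ _)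
cut-after {π = π} {i = suc i} (v ∷ vs) par (s≤s i≤k) x y
  with z , z′ , eq , cnt ← cut-after vs (par ∘ suc) i≤k (x ++ v) y =
  z , z′ , trans (++-regroup x v (concat (toList vs)) y) eq , λ c → begin
    ∣ z ∣⟨ c ⟩                            ≡⟨ cnt c ⟩
    ∣ x ++ v ∣⟨ c ⟩ + i * π c             ≡⟨ cong (_+ i * π c) (count-++ x v c) ⟩
    ∣ x ∣⟨ c ⟩ + ∣ v ∣⟨ c ⟩ + i * π c     ≡⟨ cong (λ n → ∣ x ∣⟨ c ⟩ + n + i * π c) (par zero c) ⟩
    ∣ x ∣⟨ c ⟩ + π c + i * π c            ≡⟨ +-assoc ∣ x ∣⟨ c ⟩ (π c) (i * π c) ⟩
    ∣ x ∣⟨ c ⟩ + suc i * π c              ∎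
  where open ≡-Reasoning

-- Weights modulo 11

weight : (Letter → ℕ) → ℕ
weight π = π a + 3 * π b

wt : Word → ℕ
wt u = weight (∣ u ∣⟨_⟩)

weight-+-* : ∀ {π ρ τ : Letter → ℕ} i → (∀ c → π c ≡ ρ c + i * τ c) →
             weight π ≡ weight ρ + i * weight τ
weight-+-* {π} {ρ} {τ} i eq rewrite eq a | eq b = ring (ρ a) (ρ b) i (τ a) (τ b)
  where
  ring : ∀ x y i s t → x + i * s + 3 * (y + i * t) ≡ x + 3 * y + i * (s + 3 * t)
  ring = solve-∀

wt-σ : ∀ c z → wt (σ c ++ z) % 11 ≡ wt z % 11
wt-σ a z = trans (cong (_% 11) (ring ∣ z ∣⟨ a ⟩ ∣ z ∣⟨ b ⟩)) ([m+n]%n≡m%n (wt z) 11)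
  where
  ring : ∀ x y → 5 + x + 3 * (2 + y) ≡ x + 3 * y + 11
  ring = solve-∀
wt-σ b z = trans (cong (_% 11) (ring ∣ z ∣⟨ a ⟩ ∣ z ∣⟨ b ⟩)) ([m+n]%n≡m%n (wt z) 11)
  where
  ring : ∀ x y → 2 + x + 3 * (3 + y) ≡ x + 3 * y + 11
  ring = solve-∀

Forbidden : ℕ → Set
Forbidden r = r ≡ 2 ⊎ r ≡ 9

forbidden? : ∀ r → Dec (Forbidden r)
forbidden? r = (r ℕ.≟ 2) ⊎-dec (r ℕ.≟ 9)

abstract
  -- For `d` nonzero the ten terms are distinct modulo 11 and miss a single residue, so they hit 2
  -- or 9. Ten terms are the cuts around nine blocks. The 121 cases are decided by evaluation, which
  -- `abstract` keeps from being unfolded later.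
  progression-Fin : ∀ (r d : Fin 11) → toℕ d ≡ 0 ⊎ ∃[ i ] Forbidden ((toℕ r + toℕ {10} i * toℕ d) % 11)
  progression-Fin = toWitness {a? = all? λ r → all? λ d →
    (toℕ d ℕ.≟ 0) ⊎-dec any? λ i → forbidden? ((toℕ r + toℕ i * toℕ d) % 11)} _

progression : ∀ m n → n % 11 ≡ 0 ⊎ ∃[ i ] Forbidden ((m + toℕ {10} i * n) % 11)
progression m n with progression-Fin (m mod 11) (n mod 11)
... | inj₁ n≡0 = inj₁ (trans (sym (toℕ-fromℕ< (m%n<n n 11))) n≡0)
... | inj₂ (i , forb) = inj₂ (i , subst Forbidden eq forb)
  where
  open ≡-Reasoning
  ring : ∀ r s j d e → r + j * d + (s + j * e) * 11 ≡ r + s * 11 + j * (d + e * 11)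
  ring = solve-∀
  eq : (toℕ (m mod 11) + toℕ i * toℕ (n mod 11)) % 11 ≡ (m + toℕ i * n) % 11
  eq = begin
    (toℕ (m mod 11) + toℕ i * toℕ (n mod 11)) % 11
      ≡⟨ cong₂ (λ r d → (r + toℕ i * d) % 11) (toℕ-fromℕ< (m%n<n m 11)) (toℕ-fromℕ< (m%n<n n 11)) ⟩
    (m % 11 + toℕ i * (n % 11)) % 11
      -- The multiple of 11 that turns both remainders back into `m` and `n`.
      ≡⟨ [m+kn]%n≡m%n (m % 11 + toℕ i * (n % 11)) (m / 11 + toℕ i * (n / 11)) 11 ⟨
    (m % 11 + toℕ i * (n % 11) + (m / 11 + toℕ i * (n / 11)) * 11) % 11
      ≡⟨ cong (_% 11) (ring (m % 11) (m / 11) (toℕ i) (n % 11) (n / 11)) ⟩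
    (m % 11 + m / 11 * 11 + toℕ i * (n % 11 + n / 11 * 11)) % 11
      ≡⟨ cong₂ (λ r d → (r + toℕ i * d) % 11) (m≡m%n+[m/n]*n m 11) (m≡m%n+[m/n]*n n 11) ⟨
    (m + toℕ i * n) % 11 ∎

-- Moving cuts to image boundaries

-- A cut of weight 7 lies before a final ba of h(a) or a final ab of h(b), and
-- is moved to the right; the letters it skips are the lack.  Every other cut is
-- moved to the left, past the excess.
lack : ℕ → Letter → ℕ
lack 7 _ = 1
lack _ _ = 0

excess : ℕ → Letter → ℕ
excess 1  a = 1
excess 3  b = 1
excess 4  _ = 1
excess 5  a = 2
excess 5  b = 1
excess 6  a = 3
excess 6  b = 1
excess 8  _ = 2
excess 10 a = 4
excess 10 b = 2
excess _  _ = 0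

-- Corrections are added on both sides instead of subtracted. They depend on `r` and the letter
-- only, so they cancel between two cuts with the same residue.
Balanced : ℕ → Word → Word → Set
Balanced r z p = ∀ c → ∣ z ∣⟨ c ⟩ + lack r c ≡ ∣ h p ∣⟨ c ⟩ + excess r c

record Cut (u z : Word) : Set where
  constructor mkCut
  field
    left right : Word
    split      : u ≡ left ++ right
    allowed    : ¬ Forbidden (wt z % 11)
    balanced   : Balanced (wt z % 11) z left

cut-at : ∀ p q {z} {ok : False (forbidden? (wt z % 11))} →
         ∣ z ∣⟨ a ⟩ + lack (wt z % 11) a ≡ ∣ h p ∣⟨ a ⟩ + excess (wt z % 11) a →
         ∣ z ∣⟨ b ⟩ + lack (wt z % 11) b ≡ ∣ h p ∣⟨ b ⟩ + excess (wt z % 11) b →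
         Cut (p ++ q) z
cut-at p q {ok = ok} eqa eqb = mkCut p q refl (toWitnessFalse ok) λ { a → eqa ; b → eqb }

-- The prefixes of `σ a` have residues 0, 1, 4, 5, 6, 7, 10, 0, those of `σ b` have 0, 3, 4, 7, 8,
-- 0. Each clause is a closed computation.
cut-inside : ∀ c u z {w} → σ c ≡ z ++ w → Cut (c ∷ u) z
cut-inside c u []                                  _    = cut-at [] (c ∷ u) refl refl
cut-inside a u (a ∷ [])                            refl = cut-at [] (a ∷ u) refl refl
cut-inside a u (a ∷ b ∷ [])                        refl = cut-at [] (a ∷ u) refl refl
cut-inside a u (a ∷ b ∷ a ∷ [])                    refl = cut-at [] (a ∷ u) refl refl
cut-inside a u (a ∷ b ∷ a ∷ a ∷ [])                refl = cut-at [] (a ∷ u) refl refl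
-- Residue 7: the prefixes `abaaa` and `bab` are not abelian equivalent, but the remainders `ba` and
-- `ab` are, so both cuts move to the right.
cut-inside a u (a ∷ b ∷ a ∷ a ∷ a ∷ [])            refl = cut-at (a ∷ []) u refl refl
cut-inside a u (a ∷ b ∷ a ∷ a ∷ a ∷ b ∷ [])        refl = cut-at [] (a ∷ u) refl refl
cut-inside a u (a ∷ b ∷ a ∷ a ∷ a ∷ b ∷ a ∷ [])    refl = cut-at (a ∷ []) u refl refl
cut-inside b u (b ∷ [])                            refl = cut-at [] (b ∷ u) refl refl
cut-inside b u (b ∷ a ∷ [])                        refl = cut-at [] (b ∷ u) refl refl
cut-inside b u (b ∷ a ∷ b ∷ [])                    refl = cut-at (b ∷ []) u refl refl
cut-inside b u (b ∷ a ∷ b ∷ a ∷ [])                refl = cut-at [] (b ∷ u) refl refl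
cut-inside b u (b ∷ a ∷ b ∷ a ∷ b ∷ [])            refl = cut-at (b ∷ []) u refl refl

cut-∷ : ∀ c {u z} → Cut u z → Cut (c ∷ u) (σ c ++ z)
cut-∷ c {u} {z} (mkCut p q split allowed balanced) =
  mkCut (c ∷ p) q (cong (c ∷_) split)
    (subst (¬_ ∘ Forbidden) (sym (wt-σ c z)) allowed)
    (subst (λ r → Balanced r (σ c ++ z) (c ∷ p)) (sym (wt-σ c z)) λ d → begin
      ∣ σ c ++ z ∣⟨ d ⟩ + lack r d              ≡⟨ cong (_+ lack r d) (count-++ (σ c) z d) ⟩
      ∣ σ c ∣⟨ d ⟩ + ∣ z ∣⟨ d ⟩ + lack r d      ≡⟨ +-assoc ∣ σ c ∣⟨ d ⟩ _ _ ⟩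
      ∣ σ c ∣⟨ d ⟩ + (∣ z ∣⟨ d ⟩ + lack r d)    ≡⟨ cong (∣ σ c ∣⟨ d ⟩ +_) (balanced d) ⟩
      ∣ σ c ∣⟨ d ⟩ + (∣ h p ∣⟨ d ⟩ + excess r d) ≡⟨ +-assoc ∣ σ c ∣⟨ d ⟩ _ _ ⟨
      ∣ σ c ∣⟨ d ⟩ + ∣ h p ∣⟨ d ⟩ + excess r d  ≡⟨ cong (_+ excess r d) (count-++ (σ c) (h p) d) ⟨
      ∣ h (c ∷ p) ∣⟨ d ⟩ + excess r d           ∎)
  where
  open ≡-Reasoning
  r = wt z % 11

cut : ∀ u z {z′} → h u ≡ z ++ z′ → Cut u z
cut []      []  _  = cut-at [] [] refl refl
cut (c ∷ u) z   eq with levi (σ c) z eq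
... | inj₁ (w , refl , eq′) = cut-∷ c (cut u w eq′)
... | inj₂ (w , σ≡ , _)     = cut-inside c u z σ≡

-- Desubstitution of abelian powers

-- The difference of the two balances: equal residues make the corrections cancel.
balanced-extend : ∀ {r} {π : Letter → ℕ} z v p w → (∀ c → ∣ v ∣⟨ c ⟩ ≡ π c) →
                  Balanced r z p → Balanced r (z ++ v) (p ++ w) →
                  ∀ c → ∣ h w ∣⟨ c ⟩ ≡ π c
balanced-extend {r} {π} z v p w par bal bal′ c =
  +-cancelˡ-≡ (∣ h p ∣⟨ c ⟩ + excess r c) ∣ h w ∣⟨ c ⟩ (π c) (begin
    ∣ h p ∣⟨ c ⟩ + excess r c + ∣ h w ∣⟨ c ⟩  ≡⟨ swap ∣ h p ∣⟨ c ⟩ (excess r c) ∣ h w ∣⟨ c ⟩ ⟩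
    ∣ h p ∣⟨ c ⟩ + ∣ h w ∣⟨ c ⟩ + excess r c  ≡⟨ cong (_+ excess r c) (count-++ (h p) (h w) c) ⟨
    ∣ h p ++ h w ∣⟨ c ⟩ + excess r c          ≡⟨ cong (λ s → ∣ s ∣⟨ c ⟩ + excess r c) (h-++ p w) ⟨
    ∣ h (p ++ w) ∣⟨ c ⟩ + excess r c          ≡⟨ bal′ c ⟨
    ∣ z ++ v ∣⟨ c ⟩ + lack r c                ≡⟨ cong (_+ lack r c) (count-++ z v c) ⟩
    ∣ z ∣⟨ c ⟩ + ∣ v ∣⟨ c ⟩ + lack r c        ≡⟨ cong (λ n → ∣ z ∣⟨ c ⟩ + n + lack r c) (par c) ⟩
    ∣ z ∣⟨ c ⟩ + π c + lack r c               ≡⟨ swap ∣ z ∣⟨ c ⟩ (π c) (lack r c) ⟩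
    ∣ z ∣⟨ c ⟩ + lack r c + π c               ≡⟨ cong (_+ π c) (bal c) ⟩
    ∣ h p ∣⟨ c ⟩ + excess r c + π c           ∎)
  where
  open ≡-Reasoning
  swap : ∀ x y z → x + y + z ≡ x + z + y
  swap = solve-∀

-- Moved cuts keep their order: going back over `w` would force the letter counts of `h w` and `v`
-- to add up to 0.
balanced-shrink : ∀ {r} z v p w → Balanced r z (p ++ w) → Balanced r (z ++ v) p → w ≡ []
balanced-shrink {r} z v p w bal bal′ =
  count-h≡0⇒[] w λ c → m+n≡0⇒m≡0 ∣ h w ∣⟨ c ⟩ {∣ v ∣⟨ c ⟩} (+-cancelˡ-≡ (∣ h p ∣⟨ c ⟩ + excess r c) _ _ (begin
    ∣ h p ∣⟨ c ⟩ + excess r c + (∣ h w ∣⟨ c ⟩ + ∣ v ∣⟨ c ⟩)  ≡⟨ swap ∣ h p ∣⟨ c ⟩ (excess r c) ∣ h w ∣⟨ c ⟩ ∣ v ∣⟨ c ⟩ ⟩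
    ∣ h p ∣⟨ c ⟩ + ∣ h w ∣⟨ c ⟩ + excess r c + ∣ v ∣⟨ c ⟩    ≡⟨ cong (λ n → n + excess r c + ∣ v ∣⟨ c ⟩) (count-++ (h p) (h w) c) ⟨
    ∣ h p ++ h w ∣⟨ c ⟩ + excess r c + ∣ v ∣⟨ c ⟩            ≡⟨ cong (λ s → ∣ s ∣⟨ c ⟩ + excess r c + ∣ v ∣⟨ c ⟩) (h-++ p w) ⟨
    ∣ h (p ++ w) ∣⟨ c ⟩ + excess r c + ∣ v ∣⟨ c ⟩            ≡⟨ cong (_+ ∣ v ∣⟨ c ⟩) (bal c) ⟨
    ∣ z ∣⟨ c ⟩ + lack r c + ∣ v ∣⟨ c ⟩                       ≡⟨ swap′ ∣ z ∣⟨ c ⟩ (lack r c) ∣ v ∣⟨ c ⟩ ⟩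
    ∣ z ∣⟨ c ⟩ + ∣ v ∣⟨ c ⟩ + lack r c                       ≡⟨ cong (_+ lack r c) (count-++ z v c) ⟨
    ∣ z ++ v ∣⟨ c ⟩ + lack r c                               ≡⟨ bal′ c ⟩
    ∣ h p ∣⟨ c ⟩ + excess r c                                ≡⟨ +-identityʳ _ ⟨
    ∣ h p ∣⟨ c ⟩ + excess r c + 0                            ∎))
  where
  open ≡-Reasoning
  swap : ∀ x e y z → x + e + (y + z) ≡ x + y + e + z
  swap = solve-∀
  swap′ : ∀ x y z → x + y + z ≡ x + z + y
  swap′ = solve-∀

wt-++-≡ : ∀ {π} z v → weight π % 11 ≡ 0 → (∀ c → ∣ v ∣⟨ c ⟩ ≡ π c) →
          wt (z ++ v) % 11 ≡ wt z % 11
wt-++-≡ {π} z v π≡0 par = trans (cong (_% 11) wt≡)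
  (%-remove-+ʳ (wt z) (m%n≡0⇒n∣m (1 * weight π) 11 (trans (cong (_% 11) (+-identityʳ (weight π))) π≡0)))
  where
  wt≡ : wt (z ++ v) ≡ wt z + 1 * weight π
  wt≡ = weight-+-* {ρ = ∣ z ∣⟨_⟩} {τ = π} 1 λ c →
    trans (count-++ z v c) (cong (∣ z ∣⟨ c ⟩ +_) (trans (par c) (sym (+-identityʳ (π c)))))

-- Induction over the blocks, with `z` the current cut and `p` the prefix at its moved position.
-- Since `π` has weight 0 modulo 11, all cuts share the residue `r`, and `balanced-extend` applies
-- between neighbours.
desubstitute : ∀ {k π r u y p q} z (vs : Vec Word k) →
  HasParikh π vs → weight π % 11 ≡ 0 →
  h u ≡ z ++ concat (toList vs) ++ y → wt z % 11 ≡ r →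
  u ≡ p ++ q → Balanced r z p →
  ∃[ ws ] ∃[ t ] q ≡ concat (toList {n = k} ws) ++ t ×
    (∀ i c → ∣ h (lookup ws i) ∣⟨ c ⟩ ≡ π c)
desubstitute {q = q} z [] _ _ _ _ _ _ = [] , q , refl , λ ()
desubstitute {π = π} {u = u} {y} {p} {q} z (v ∷ vs) par π≡0 eq refl u≡pq bal =
  go (levi p p′ (trans (sym u≡pq) split))
  where
  eq′ : h u ≡ (z ++ v) ++ concat (toList vs) ++ y
  eq′ = trans eq (++-regroup z v (concat (toList vs)) y)
  wt≡ : wt (z ++ v) % 11 ≡ wt z % 11
  wt≡ = wt-++-≡ z v π≡0 (par zero)
  open Cut (cut u (z ++ v) eq′) renaming (left to p′; right to q′)
  bal′ : Balanced (wt z % 11) (z ++ v) p′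
  bal′ = subst (λ r → Balanced r (z ++ v) p′) wt≡ balanced
  extend : ∀ w → p′ ≡ p ++ w → q ≡ w ++ q′ → _
  extend w p′≡ q≡ with ws , t , q′≡ , par′ ← desubstitute (z ++ v) vs (par ∘ suc) π≡0 eq′ wt≡ split bal′ =
    w ∷ ws , t , trans q≡ (trans (cong (w ++_) q′≡) (sym (++-assoc w (concat (toList ws)) t))) ,
    λ { zero    → balanced-extend {π = π} z v p w (par zero) bal (subst (Balanced (wt z % 11) (z ++ v)) p′≡ bal′)
      ; (suc i) → par′ i }
  go : (∃[ w ] p′ ≡ p ++ w × q ≡ w ++ q′) ⊎ (∃[ w ] p ≡ p′ ++ w × q′ ≡ w ++ q) → _
  go (inj₁ (w , p′≡ , q≡)) = extend w p′≡ q≡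
  -- Here the next moved cut is not to the right of `p`, so it coincides with `p` and the block of
  -- `u` is empty.
  go (inj₂ (w , p≡ , q′≡))
    with refl ← balanced-shrink z v p′ w (subst (Balanced (wt z % 11) z) p≡ bal) bal′ =
    extend [] (sym (trans (++-identityʳ p) (trans p≡ (++-identityʳ p′)))) (sym q′≡)

h-powerFree : AbelianPowerFreeMorphism 9 h
h-powerFree u free x vs y eq same with progression (wt x) (weight ∣ lookup vs zero ∣⟨_⟩)
-- The cut after `i` blocks would have a forbidden residue, which no prefix of `h u` has.
... | inj₂ (i , forb) = contradiction (subst (Forbidden ∘ (_% 11)) (sym wt≡) forb) (Cut.allowed (cut u z (trans eq eq′)))
  where
  after = cut-after vs (SameParikh⇒HasParikh vs same) (ℕ.s≤s⁻¹ (toℕ<n i)) x y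
  z = proj₁ after
  eq′ = proj₁ (proj₂ (proj₂ after))
  wt≡ : wt z ≡ wt x + toℕ i * weight ∣ lookup vs zero ∣⟨_⟩
  wt≡ = weight-+-* {ρ = ∣ x ∣⟨_⟩} {τ = ∣ lookup vs zero ∣⟨_⟩} (toℕ i) (proj₂ (proj₂ (proj₂ after)))
... | inj₁ π≡0 with mkCut p q u≡pq _ bal ← cut u x eq
               with ws , t , q≡ , par ← desubstitute x vs (SameParikh⇒HasParikh vs same) π≡0 eq refl u≡pq bal
  -- The words `ws` form an abelian 9-power in `u`, so they are empty, and the common vector is that
  -- of `h []`.
  = HasParikh-0⇒AllEmpty vs (SameParikh⇒HasParikh vs same) λ c →
      trans (sym (par zero c)) (cong (λ w → ∣ h w ∣⟨ c ⟩) (empty zero))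
  where
  empty : AllEmpty ws
  empty = free p ws t (trans u≡pq (cong (p ++_) q≡)) λ i j →
    count-ψ (lookup ws i) (lookup ws j)
      (count-h-injective (lookup ws i) (lookup ws j) λ c → trans (par i c) (sym (par j c)))

-- The fixed point

H : ℕ → Word
H zero    = a ∷ []
H (suc n) = h (H n)

H-powerFree : ∀ n → AbelianPowerFree 9 (H n)
H-powerFree (suc n) = h-powerFree (H n) (H-powerFree n)
H-powerFree zero x vs y eq same
  -- The cut after all nine blocks: a letter occurring in each block would occur nine times in a
  -- one-letter word.
  with z , z′ , eq′ , cnt ← cut-after vs (SameParikh⇒HasParikh vs same) ≤-refl x y =
  HasParikh-0⇒AllEmpty vs (SameParikh⇒HasParikh vs same) λ c → small (bound c)
  where
  open ≤-Reasoning
  count-letter≤1 : ∀ c → ∣ a ∷ [] ∣⟨ c ⟩ ≤ 1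
  count-letter≤1 a = s≤s z≤n
  count-letter≤1 b = z≤n
  π = ∣ lookup vs zero ∣⟨_⟩
  bound : ∀ c → 9 * π c ≤ 1
  bound c = begin
    9 * π c                       ≤⟨ m≤n+m (9 * π c) ∣ x ∣⟨ c ⟩ ⟩
    ∣ x ∣⟨ c ⟩ + 9 * π c          ≡⟨ cnt c ⟨
    ∣ z ∣⟨ c ⟩                    ≤⟨ m≤m+n ∣ z ∣⟨ c ⟩ ∣ z′ ∣⟨ c ⟩ ⟩
    ∣ z ∣⟨ c ⟩ + ∣ z′ ∣⟨ c ⟩      ≡⟨ count-++ z z′ c ⟨
    ∣ z ++ z′ ∣⟨ c ⟩              ≡⟨ cong ∣_∣⟨ c ⟩ (trans eq eq′) ⟨
    ∣ a ∷ [] ∣⟨ c ⟩               ≤⟨ count-letter≤1 c ⟩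
    1                             ∎
  small : ∀ {n} → 9 * n ≤ 1 → n ≡ 0
  small {zero}  _ = refl
  small {suc n} le with s≤s () ← ≤-trans (*-monoʳ-≤ 9 (s≤s (z≤n {n}))) le

T : ℕ → Word
T zero    = b ∷ a ∷ a ∷ a ∷ b ∷ a ∷ []
T (suc n) = h (T n)

-- `h` applied `n` times to the factorization of `σ a` into `a` and `T 0`. Hence each `H n` is a
-- prefix of the next.
H-suc : ∀ n → H (suc n) ≡ H n ++ T n
H-suc zero    = refl
H-suc (suc n) = trans (cong h (H-suc n)) (h-++ (H n) (T n))

T-nonempty : ∀ n → 1 ≤ length (T n)
T-nonempty zero    = s≤s z≤n
T-nonempty (suc n) = h-nonempty (T n) (T-nonempty n)
  where
  h-nonempty : ∀ u → 1 ≤ length u → 1 ≤ length (h u)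
  h-nonempty (a ∷ u) _ = s≤s z≤n
  h-nonempty (b ∷ u) _ = s≤s z≤n

n<length-H : ∀ n → n < length (H n)
n<length-H zero    = s≤s z≤n
n<length-H (suc n) rewrite H-suc n | length-++ (H n) {T n} =
  ≤-trans (≤-reflexive (+-comm 1 (suc n))) (+-mono-≤ (n<length-H n) (T-nonempty n))

H-extends : ∀ k n → ∃[ w ] H (k + n) ≡ H n ++ w
H-extends zero    n = [] , sym (++-identityʳ (H n))
H-extends (suc k) n with w , eq ← H-extends k n =
  w ++ T (k + n) , trans (H-suc (k + n)) (trans (cong (_++ T (k + n)) eq) (++-assoc (H n) w _))

-- The infinite word as the limit of the words `H n`

letterAt : Word → ℕ → Letter
letterAt []      _       = a
letterAt (c ∷ u) zero    = c
letterAt (c ∷ u) (suc i) = letterAt u i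

letterAt-++ : ∀ u v {i} → i < length u → letterAt (u ++ v) i ≡ letterAt u i
letterAt-++ (c ∷ u) v {zero}  _         = refl
letterAt-++ (c ∷ u) v {suc i} (s≤s i<u) = letterAt-++ u v i<u

-- By `n<length-H` position `i` lies inside `H i`, so the default value of `letterAt` is never
-- returned.
Ω : InfWord
Ω i = letterAt (H i) i

-- `H i` and `H n` are both prefixes of `H (n + i)`.
Ω-H : ∀ n i → i < length (H n) → Ω i ≡ letterAt (H n) i
Ω-H n i i<n with w , eq ← H-extends n i | w′ , eq′ ← H-extends i n = begin
  letterAt (H i) i          ≡⟨ letterAt-++ (H i) w (n<length-H i) ⟨
  letterAt (H i ++ w) i     ≡⟨ cong (λ u → letterAt u i) eq ⟨
  letterAt (H (n + i)) i    ≡⟨ cong (λ m → letterAt (H m) i) (+-comm n i) ⟩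
  letterAt (H (i + n)) i    ≡⟨ cong (λ u → letterAt u i) eq′ ⟩
  letterAt (H n ++ w′) i    ≡⟨ letterAt-++ (H n) w′ i<n ⟩
  letterAt (H n) i          ∎
  where open ≡-Reasoning

prefix-cong : ∀ {w w′} → w ≗ w′ → ∀ n → prefix w n ≡ prefix w′ n
prefix-cong eq zero    = refl
prefix-cong eq (suc n) = cong₂ _∷_ (eq 0) (prefix-cong (eq ∘ suc) n)

prefix-letterAt : ∀ w u → (∀ i → i < length u → w i ≡ letterAt u i) → prefix w (length u) ≡ u
prefix-letterAt w []      _  = refl
prefix-letterAt w (c ∷ u) eq =
  cong₂ _∷_ (eq 0 (s≤s z≤n)) (prefix-letterAt (w ∘ suc) u λ i i<u → eq (suc i) (s≤s i<u))

prefix-+ : ∀ w m n → prefix w (m + n) ≡ prefix w m ++ prefix (w ∘ (m +_)) n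
prefix-+ w zero    n = refl
prefix-+ w (suc m) n = cong (w 0 ∷_) (prefix-+ (w ∘ suc) m n)

prefix-++ω : ∀ u w n → prefix (u ++ω w) (length u + n) ≡ u ++ prefix w n
prefix-++ω []      w n = refl
prefix-++ω (c ∷ u) w n = cong (c ∷_) (prefix-++ω u w n)

prefix-Ω : ∀ n → prefix Ω (length (H n)) ≡ H n
prefix-Ω n = prefix-letterAt Ω (H n) (Ω-H n)

-- The index is a successor so that the word is an image `h (H n)`, as `Ω-fixed` requires.
H-prefix : ∀ m → ∃[ n ] ∃[ k ] H (suc n) ≡ prefix Ω (m + k)
H-prefix m = m , length (H (suc m)) ∸ m , trans (sym (prefix-Ω (suc m)))
  (cong (prefix Ω) (sym (m+[n∸m]≡n (<⇒≤ (<-≤-trans (n<1+n m) (<⇒≤ (n<length-H (suc m))))))))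

Ω-fixed : IsFixedPoint h Ω
Ω-fixed m with n , k , eq ← H-prefix m =
  length (H n) , prefix (Ω ∘ (m +_)) k ,
  trans (cong h (prefix-Ω n)) (trans eq (prefix-+ Ω m k))

-- Carries questions about factors of `Ω` over to the finite words `H n`, by truncating inside the
-- tail `y`.
factor-H : ∀ x v {y} → Ω ≗ x ++ω v ++ω y → ∃[ n ] ∃[ y′ ] H n ≡ x ++ v ++ y′
factor-H x v {y} eq with n , k , H≡ ← H-prefix (length x + length v) =
  suc n , prefix y k , (begin
    H (suc n)                                                   ≡⟨ H≡ ⟩
    prefix Ω (length x + length v + k)                          ≡⟨ cong (prefix Ω) (+-assoc (length x) _ k) ⟩
    prefix Ω (length x + (length v + k))                        ≡⟨ prefix-cong eq (length x + (length v + k)) ⟩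
    prefix (x ++ω v ++ω y) (length x + (length v + k))          ≡⟨ prefix-++ω x (v ++ω y) (length v + k) ⟩
    x ++ prefix (v ++ω y) (length v + k)                        ≡⟨ cong (x ++_) (prefix-++ω v y k) ⟩
    x ++ v ++ prefix y k                                        ∎)
  where open ≡-Reasoning

Ω-powerFree : AbelianPowerFreeω 9 Ω
Ω-powerFree x vs y eq with n , y′ , H≡ ← factor-H x (concat (toList vs)) eq =
  H-powerFree n x vs y′ H≡

-- The factors `aaaa` and `bb`

-- The index bounds the number of letters a at the start of the word; its value
-- is 3 just after a letter b, where another b is not allowed.
data Tame : ℕ → Word → Set where
  []  : ∀ {k} → Tame k []
  a∷_ : ∀ {k u} → Tame k u → Tame (suc k) (a ∷ u)
  b∷  : ∀ {k u} → k < 3 → Tame 3 u → Tame k (b ∷ u)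

-- `tame-h` serves at the start and after an image `σ a`, whose end `ba` leaves room for two letters
-- `a`. `tame-h₃` serves after `σ b`: there `u` cannot start with `b`, so neither does `h u`, and no
-- `bb` arises at the boundary.
tame-h  : ∀ {k u} → k < 3 → Tame k u → Tame 2 (h u)
tame-h₃ : ∀ {u} → Tame 3 u → Tame 3 (h u)

tame-h _   []        = []
tame-h k<3 (a∷ t)    =
  a∷ b∷ (n≤1+n 2) (a∷ a∷ a∷ b∷ (s≤s z≤n) (a∷ tame-h (<⇒≤ k<3) t))
tame-h k<3 (b∷ _ t)  = b∷ ≤-refl (a∷ b∷ ≤-refl (a∷ b∷ ≤-refl (tame-h₃ t)))

tame-h₃ []              = []
tame-h₃ (a∷ t)          = a∷ b∷ ≤-refl (a∷ a∷ a∷ b∷ (s≤s z≤n) (a∷ tame-h ≤-refl t))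
tame-h₃ (b∷ 3<3 _)      = contradiction 3<3 (n≮n 3)

H-tame : ∀ n → Tame 2 (H n)
H-tame zero    = a∷ []
H-tame (suc n) = tame-h ≤-refl (H-tame n)

tame-suffix : ∀ {k} x {u} → k ≤ 3 → Tame k (x ++ u) → ∃[ j ] j ≤ 3 × Tame j u
tame-suffix []      k≤3 t        = _ , k≤3 , t
tame-suffix (a ∷ x) k≤3 (a∷ t)   = tame-suffix x (<⇒≤ k≤3) t
tame-suffix (b ∷ x) _   (b∷ _ t) = tame-suffix x ≤-refl t

Ω-factor-tame : ∀ v → IsFactorω v Ω → ∃[ j ] ∃[ y ] j ≤ 3 × Tame j (v ++ y)
Ω-factor-tame v (x , y , eq)
  with n , y′ , H≡ ← factor-H x v eq
  with j , j≤3 , t ← tame-suffix x (n≤1+n 2) (subst (Tame 2) H≡ (H-tame n)) =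
  j , y′ , j≤3 , t

Ω-aaaa-free : ¬ IsFactorω (a ∷ a ∷ a ∷ a ∷ []) Ω
Ω-aaaa-free f with Ω-factor-tame (a ∷ a ∷ a ∷ a ∷ []) f
-- Four leading letters `a` force an index of at least 4, against the bound 3.
... | _ , _ , s≤s (s≤s (s≤s ())) , a∷ a∷ a∷ a∷ _

Ω-bb-free : ¬ IsFactorω (b ∷ b ∷ []) Ω
Ω-bb-free f with Ω-factor-tame (b ∷ b ∷ []) f
... | _ , _ , _ , b∷ _ (b∷ 3<3 _) = n≮n 3 3<3

theorem2p16 : ∃[ h ] IsMorphism h × AbelianPowerFreeMorphism 9 h ×
    (∃[ Ω₂ ] IsFixedPoint h Ω₂ ×
    ¬ IsFactorω (a ∷ a ∷ a ∷ a ∷ []) Ω₂ ×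
    ¬ IsFactorω (b ∷ b ∷ []) Ω₂ ×
    AbelianPowerFreeω 9 Ω₂)
theorem2p16 = h , h-isMorphism , h-powerFree ,
  Ω , Ω-fixed , Ω-aaaa-free , Ω-bb-free , Ω-powerFree
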